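{- Let $L$ be a finite lattice, let $\mathrm{bel}_1,\mathrm{bel}_2$ be two belief functions on $L$ with co-Möbius transforms $q_1,q_2$, and let $q$ denote the co-Möbius transform of their Dempster combination $\mathrm{bel}:=\mathrm{bel}_1\oplus\mathrm{bel}_2$. Then $$q(x)=q_1(x)\,q_2(x),\qquad\forall x\in L.$$
   Context: For a function $f:L\to\mathbb{R}$ on a finite lattice $L$ (least element $\bot$, greatest element $\top$), its Möbius transform is the unique function $m:L\to\mathbb{R}$ with $f(x)=\sum_{y\leq x}m(y)$ for all $x\in L$. The co-Möbius transform of $f$ is $q(x):=\sum_{y\geq x}m(y)$, $x\in L$. A belief function on $L$ is a function $\mathrm{bel}:L\to[0,1]$ with $\mathrm{bel}(\top)=1$, $\mathrm{bel}(\bot)=0$, and whose Möbius transform is nonnegative. The Dempster rule of combination $\mathrm{bel}_1\oplus\mathrm{bel}_2$ of belief functions with Möbius transforms $m_1,m_2$ is the function on $L$ whose Möbius transform is $m(x)=(m_1\oplus m_2)(x):=\sum_{y_1\wedge y_2=x}m_1(y_1)m_2(y_2)$ for all $x\in L$ (no normalization; the value at $\bot$ is not reset to $0$). -}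

module Defs where

open import Algebra.Bundles using (CommutativeRing)
open import Data.Bool.Base using (if_then_else_)
open import Data.Fin.Base using (Fin; zero; suc)
import Data.Fin.Properties as Fin
open import Data.Fin.Induction using (po-wellFounded)
open import Data.Nat.Base as ℕ using (ℕ)
import Data.Nat.Properties as ℕ
open import Data.Product.Base using (Σ-syntax; ∃-syntax; _×_; _,_; proj₁; proj₂)
open import Data.Product using (∃!)
open import Data.Rational.Base as ℚ using (ℚ; 0ℚ; 1ℚ; ½; ∣_∣)
import Data.Rational.Properties as ℚ
open import Data.Rational.Solver using (module +-*-Solver)
open import Function.Bundles using (Func; Inverse)
open import Function.Properties.Inverse using (Inverse⇒Injection) renaming (sym to ↔-sym)
open import Induction.WellFounded using (Acc; acc; WellFounded)
open import Level using (_⊔_) renaming (suc to lsuc)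
open import Relation.Binary.Bundles using (Setoid)
open import Relation.Binary.Definitions using (Decidable)
open import Relation.Binary.Lattice.Bundles using (BoundedLattice)
import Relation.Binary.Lattice.Properties.MeetSemilattice as MeetSemilatticeProperties
open import Relation.Binary.PropositionalEquality as ≡ using (_≡_)
open import Relation.Binary.Structures using (IsPartialOrder)
open import Relation.Nullary using (Dec; yes; no; does; ¬_)
open import Relation.Nullary.Decidable using (via-injection; ¬?; _×-dec_)
open import Relation.Nullary.Negation using (contradiction)

-- a ∼ a is exactly the Cauchy condition, and for Cauchy sequences a and b,
-- a ∼ b says that a - b tends to 0.  Hence (Cauchy sequences of rationals, ∼)
-- is ℝ, and one lemma per operation yields both closure and congruence.

_∼_ : (a b : ℕ → ℚ) → Set
a ∼ b = ∀ ε → 0ℚ ℚ.< ε →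
        ∃[ N ] (∀ m n → N ℕ.≤ m → N ℕ.≤ n → ∣ a m ℚ.- b n ∣ ℚ.< ε)

private
  half>0 : ∀ {ε} → 0ℚ ℚ.< ε → 0ℚ ℚ.< ε ℚ.* ½
  half>0 {ε} 0<ε = ≡.subst (ℚ._< ε ℚ.* ½) (ℚ.*-zeroˡ ½) (ℚ.*-monoˡ-<-pos ½ 0<ε)

  half+half : ∀ ε → ε ℚ.* ½ ℚ.+ ε ℚ.* ½ ≡ ε
  half+half ε = ≡.trans (≡.sym (ℚ.*-distribˡ-+ ε ½ ½)) (ℚ.*-identityʳ ε)

  ∼-sym : ∀ {a b} → a ∼ b → b ∼ a
  ∼-sym {a} {b} p ε 0<ε with p ε 0<ε
  ... | N , h = N , λ m n N≤m N≤n →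
    ≡.subst (ℚ._< ε) (swap (a n) (b m)) (h n m N≤n N≤m)
    where
    open +-*-Solver
    swap : ∀ x y → ∣ x ℚ.- y ∣ ≡ ∣ y ℚ.- x ∣
    swap x y = ≡.trans (≡.sym (ℚ.∣-p∣≡∣p∣ (x ℚ.- y)))
      (≡.cong ∣_∣ (solve 2 (λ x y → :- (x :- y) := y :- x) ≡.refl x y))

  split : ∀ {p d₁ d₂ ε} → p ≡ d₁ ℚ.+ d₂ →
          ∣ d₁ ∣ ℚ.< ε ℚ.* ½ → ∣ d₂ ∣ ℚ.< ε ℚ.* ½ → ∣ p ∣ ℚ.< ε
  split {p} {d₁} {d₂} {ε} eq h₁ h₂ = begin-strict
    ∣ p ∣                  ≡⟨ ≡.cong ∣_∣ eq ⟩
    ∣ d₁ ℚ.+ d₂ ∣          ≤⟨ ℚ.∣p+q∣≤∣p∣+∣q∣ d₁ d₂ ⟩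
    ∣ d₁ ∣ ℚ.+ ∣ d₂ ∣      <⟨ ℚ.+-mono-< h₁ h₂ ⟩
    ε ℚ.* ½ ℚ.+ ε ℚ.* ½    ≡⟨ half+half ε ⟩
    ε                      ∎
    where open ℚ.≤-Reasoning

  ∼-trans : ∀ {a b c} → a ∼ b → b ∼ c → a ∼ c
  ∼-trans {a} {b} {c} p q ε 0<ε
    with p (ε ℚ.* ½) (half>0 0<ε) | q (ε ℚ.* ½) (half>0 0<ε)
  ... | M , h | N , k = M ℕ.⊔ N , λ m n l₁ l₂ →
    split (telescope (a m) (b (M ℕ.⊔ N)) (c n))
      (h m (M ℕ.⊔ N) (ℕ.≤-trans (ℕ.m≤m⊔n M N) l₁) (ℕ.m≤m⊔n M N))
      (k (M ℕ.⊔ N) n (ℕ.m≤n⊔m M N) (ℕ.≤-trans (ℕ.m≤n⊔m M N) l₂))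
    where
    open +-*-Solver
    telescope : ∀ x y z → x ℚ.- z ≡ (x ℚ.- y) ℚ.+ (y ℚ.- z)
    telescope = solve 3 (λ x y z → x :- z := (x :- y) :+ (y :- z)) ≡.refl

  ∼-pointwise : ∀ {a b} → (∀ n → a n ≡ b n) → a ∼ a → a ∼ b
  ∼-pointwise {a} eq p ε 0<ε with p ε 0<ε
  ... | N , h = N , λ m n N≤m N≤n →
    ≡.subst (λ z → ∣ a m ℚ.- z ∣ ℚ.< ε) (eq n) (h m n N≤m N≤n)

  ∼-const : ∀ q → (λ _ → q) ∼ (λ _ → q)
  ∼-const q ε 0<ε = 0 , λ _ _ _ _ →
    ≡.subst (λ z → ∣ z ∣ ℚ.< ε) (≡.sym (ℚ.+-inverseʳ q)) 0<ε

  ∼-+ : ∀ {a b c d} → a ∼ b → c ∼ d →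
        (λ n → a n ℚ.+ c n) ∼ (λ n → b n ℚ.+ d n)
  ∼-+ {a} {b} {c} {d} p q ε 0<ε
    with p (ε ℚ.* ½) (half>0 0<ε) | q (ε ℚ.* ½) (half>0 0<ε)
  ... | M , h | N , k = M ℕ.⊔ N , λ m n l₁ l₂ →
    split (rearrange (a m) (b n) (c m) (d n))
      (h m n (ℕ.≤-trans (ℕ.m≤m⊔n M N) l₁) (ℕ.≤-trans (ℕ.m≤m⊔n M N) l₂))
      (k m n (ℕ.≤-trans (ℕ.m≤n⊔m M N) l₁) (ℕ.≤-trans (ℕ.m≤n⊔m M N) l₂))
    where
    open +-*-Solver
    rearrange : ∀ x y z w →
      (x ℚ.+ z) ℚ.- (y ℚ.+ w) ≡ (x ℚ.- y) ℚ.+ (z ℚ.- w)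
    rearrange = solve 4 (λ x y z w →
      (x :+ z) :- (y :+ w) := (x :- y) :+ (z :- w)) ≡.refl

  ∼-neg : ∀ {a b} → a ∼ b → (λ n → ℚ.- a n) ∼ (λ n → ℚ.- b n)
  ∼-neg {a} {b} p ε 0<ε with p ε 0<ε
  ... | N , h = N , λ m n N≤m N≤n →
    ≡.subst (ℚ._< ε) (flip-sign (a m) (b n)) (h m n N≤m N≤n)
    where
    open +-*-Solver
    flip-sign : ∀ x y → ∣ x ℚ.- y ∣ ≡ ∣ ℚ.- x ℚ.- ℚ.- y ∣
    flip-sign x y = ≡.trans (≡.sym (ℚ.∣-p∣≡∣p∣ (x ℚ.- y)))
      (≡.cong ∣_∣ (solve 2 (λ x y → :- (x :- y) := :- x :- :- y) ≡.refl x y))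

  bounded : ∀ {a b} → a ∼ b →
            ∃[ B ] ℚ.Positive B × (∃[ N ] (∀ n → N ℕ.≤ n → ∣ a n ∣ ℚ.≤ B))
  bounded {a} {b} p with p 1ℚ (ℚ.positive⁻¹ 1ℚ)
  ... | N , h = 1ℚ ℚ.+ ∣ b N ∣
              , ℚ.pos+nonNeg⇒pos 1ℚ ∣ b N ∣ {{ℚ.∣-∣-nonNeg (b N)}}
              , N , λ n N≤n → ℚ.<⇒≤ (begin-strict
    ∣ a n ∣                       ≡⟨ ≡.cong ∣_∣ (add-back (a n) (b N)) ⟩
    ∣ (a n ℚ.- b N) ℚ.+ b N ∣     ≤⟨ ℚ.∣p+q∣≤∣p∣+∣q∣ (a n ℚ.- b N) (b N) ⟩
    ∣ a n ℚ.- b N ∣ ℚ.+ ∣ b N ∣   <⟨ ℚ.+-monoˡ-< ∣ b N ∣ (h n N N≤n ℕ.≤-refl) ⟩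
    1ℚ ℚ.+ ∣ b N ∣                ∎)
    where
    open ℚ.≤-Reasoning
    open +-*-Solver
    add-back : ∀ x y → x ≡ (x ℚ.- y) ℚ.+ y
    add-back = solve 2 (λ x y → x := (x :- y) :+ y) ≡.refl

  shrink : ∀ B .{{_ : ℚ.Positive B}} {ε} → 0ℚ ℚ.< ε →
           ∃[ δ ] 0ℚ ℚ.< δ × B ℚ.* δ ≡ ε
  shrink B {ε} 0<ε = 1/B ℚ.* ε , δ>0 , (begin
    B ℚ.* (1/B ℚ.* ε)   ≡⟨ ℚ.*-assoc B 1/B ε ⟨
    (B ℚ.* 1/B) ℚ.* ε   ≡⟨ ≡.cong (ℚ._* ε) (ℚ.*-inverseʳ B {{ℚ.pos⇒nonZero B}}) ⟩
    1ℚ ℚ.* ε            ≡⟨ ℚ.*-identityˡ ε ⟩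
    ε                   ∎)
    where
    open ≡.≡-Reasoning
    1/B = (ℚ.1/ B) {{ℚ.pos⇒nonZero B}}
    δ>0 : 0ℚ ℚ.< 1/B ℚ.* ε
    δ>0 = ≡.subst (ℚ._< 1/B ℚ.* ε) (ℚ.*-zeroʳ 1/B)
            (ℚ.*-monoʳ-<-pos 1/B {{ℚ.1/pos⇒pos B}} 0<ε)

  scaled : ∀ {B x y δ ε} .{{_ : ℚ.Positive B}} → ∣ x ∣ ℚ.≤ B →
           B ℚ.* δ ≡ ε → ∣ y ∣ ℚ.< δ → ∣ x ℚ.* y ∣ ℚ.< ε
  scaled {B} {x} {y} {δ} {ε} x≤B Bδ≡ε y<δ = begin-strict
    ∣ x ℚ.* y ∣       ≡⟨ ℚ.∣p*q∣≡∣p∣*∣q∣ x y ⟩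
    ∣ x ∣ ℚ.* ∣ y ∣   ≤⟨ ℚ.*-monoʳ-≤-nonNeg ∣ y ∣ {{ℚ.∣-∣-nonNeg y}} x≤B ⟩
    B ℚ.* ∣ y ∣       <⟨ ℚ.*-monoʳ-<-pos B y<δ ⟩
    B ℚ.* δ           ≡⟨ Bδ≡ε ⟩
    ε                 ∎
    where open ℚ.≤-Reasoning

  ∼-* : ∀ {a b c d} → a ∼ b → c ∼ d →
        (λ n → a n ℚ.* c n) ∼ (λ n → b n ℚ.* d n)
  ∼-* {a} {b} {c} {d} p q ε 0<ε = combine
    (bounded {a} {b} p) (bounded {d} {c} (∼-sym {c} {d} q))
    where
    rearrange : ∀ x y z w →
      (x ℚ.* z) ℚ.- (y ℚ.* w) ≡ x ℚ.* (z ℚ.- w) ℚ.+ w ℚ.* (x ℚ.- y)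
    rearrange = solve 4 (λ x y z w →
      (x :* z) :- (y :* w) := x :* (z :- w) :+ w :* (x :- y)) ≡.refl
      where open +-*-Solver

    combine :
      ∃[ A ] ℚ.Positive A × (∃[ K ] (∀ n → K ℕ.≤ n → ∣ a n ∣ ℚ.≤ A)) →
      ∃[ D ] ℚ.Positive D × (∃[ L ] (∀ n → L ℕ.≤ n → ∣ d n ∣ ℚ.≤ D)) →
      ∃[ N ] (∀ m n → N ℕ.≤ m → N ℕ.≤ n →
              ∣ a m ℚ.* c m ℚ.- b n ℚ.* d n ∣ ℚ.< ε)
    combine (A , A>0 , K , a≤A) (D , D>0 , L , d≤D) =
      let δ , δ>0 , Aδ = shrink A {{A>0}} (half>0 0<ε)
          η , η>0 , Dη = shrink D {{D>0}} (half>0 0<ε)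
          M , h = q δ δ>0
          N , k = p η η>0
          KL = K ℕ.⊔ L
          MN = M ℕ.⊔ N
      in KL ℕ.⊔ MN , λ m n l₁ l₂ →
        let KL≤m = ℕ.m⊔n≤o⇒m≤o KL MN l₁
            KL≤n = ℕ.m⊔n≤o⇒m≤o KL MN l₂
            MN≤m = ℕ.m⊔n≤o⇒n≤o KL MN l₁
            MN≤n = ℕ.m⊔n≤o⇒n≤o KL MN l₂
        in split {d₁ = a m ℚ.* (c m ℚ.- d n)} {d₂ = d n ℚ.* (a m ℚ.- b n)}
          (rearrange (a m) (b n) (c m) (d n))
          (scaled {A} {a m} {c m ℚ.- d n} {{A>0}} (a≤A m (ℕ.m⊔n≤o⇒m≤o K L KL≤m)) Aδ
            (h m n (ℕ.m⊔n≤o⇒m≤o M N MN≤m) (ℕ.m⊔n≤o⇒m≤o M N MN≤n)))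
          (scaled {D} {d n} {a m ℚ.- b n} {{D>0}} (d≤D n (ℕ.m⊔n≤o⇒n≤o K L KL≤n)) Dη
            (k m n (ℕ.m⊔n≤o⇒n≤o M N MN≤m) (ℕ.m⊔n≤o⇒n≤o M N MN≤n)))

-- ℝ has no η, and _≈ᵣ_ and _≤ᵣ_ are records, so that Agda can infer
-- real-valued implicit arguments.

record ℝ : Set where
  no-eta-equality
  field
    seq    : ℕ → ℚ
    cauchy : seq ∼ seq

open ℝ

infix 4 _≈ᵣ_ _≤ᵣ_

record _≈ᵣ_ (x y : ℝ) : Set where
  constructor mk≈
  field converge : seq x ∼ seq y

record _≤ᵣ_ (x y : ℝ) : Set where
  constructor mk≤
  field below : ∀ ε → 0ℚ ℚ.< ε →
          ∃[ N ] (∀ m n → N ℕ.≤ m → N ℕ.≤ n → seq x m ℚ.< seq y n ℚ.+ ε)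

private
  infixl 6 _+ᵣ_
  infixl 7 _*ᵣ_

  fromℚ : ℚ → ℝ
  seq    (fromℚ q) _ = q
  cauchy (fromℚ q)   = ∼-const q

  _+ᵣ_ : ℝ → ℝ → ℝ
  seq    (x +ᵣ y) n = seq x n ℚ.+ seq y n
  cauchy (x +ᵣ y)   = ∼-+ {seq x} {seq x} (cauchy x) (cauchy y)

  _*ᵣ_ : ℝ → ℝ → ℝ
  seq    (x *ᵣ y) n = seq x n ℚ.* seq y n
  cauchy (x *ᵣ y)   = ∼-* {seq x} {seq x} (cauchy x) (cauchy y)

  -ᵣ_ : ℝ → ℝ
  seq    (-ᵣ x) n = ℚ.- seq x n
  cauchy (-ᵣ x)   = ∼-neg {seq x} {seq x} (cauchy x)

  pointwise : ∀ {x y} → (∀ n → seq x n ≡ seq y n) → x ≈ᵣ y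
  pointwise {x} {y} eq = mk≈ (∼-pointwise {seq x} {seq y} eq (cauchy x))

ℝ-commutativeRing : CommutativeRing _ _
ℝ-commutativeRing = record
  { Carrier = ℝ
  ; _≈_ = _≈ᵣ_
  ; _+_ = _+ᵣ_
  ; _*_ = _*ᵣ_
  ; -_  = -ᵣ_
  ; 0#  = fromℚ 0ℚ
  ; 1#  = fromℚ 1ℚ
  ; isCommutativeRing = record
    { isRing = record
      { +-isAbelianGroup = record
        { isGroup = record
          { isMonoid = record
            { isSemigroup = record
              { isMagma = record
                { isEquivalence = record
                  { refl  = λ {x} → mk≈ (cauchy x)
                  ; sym   = λ {x} {y} (mk≈ p) → mk≈ (∼-sym {seq x} {seq y} p)
                  ; trans = λ {x} {y} {z} (mk≈ p) (mk≈ q) →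
                      mk≈ (∼-trans {seq x} {seq y} {seq z} p q)
                  }
                ; ∙-cong = λ {x} {y} {u} {v} (mk≈ p) (mk≈ q) →
                    mk≈ (∼-+ {seq x} {seq y} {seq u} {seq v} p q)
                }
              ; assoc = λ x y z → pointwise λ n → ℚ.+-assoc (seq x n) (seq y n) (seq z n)
              }
            ; identity = (λ x → pointwise λ n → ℚ.+-identityˡ (seq x n))
                       , (λ x → pointwise λ n → ℚ.+-identityʳ (seq x n))
            }
          ; inverse = (λ x → pointwise λ n → ℚ.+-inverseˡ (seq x n))
                    , (λ x → pointwise λ n → ℚ.+-inverseʳ (seq x n))
          ; ⁻¹-cong = λ {x} {y} (mk≈ p) → mk≈ (∼-neg {seq x} {seq y} p)
          }
        ; comm = λ x y → pointwise λ n → ℚ.+-comm (seq x n) (seq y n)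
        }
      ; *-cong = λ {x} {y} {u} {v} (mk≈ p) (mk≈ q) →
          mk≈ (∼-* {seq x} {seq y} {seq u} {seq v} p q)
      ; *-assoc = λ x y z → pointwise λ n → ℚ.*-assoc (seq x n) (seq y n) (seq z n)
      ; *-identity = (λ x → pointwise λ n → ℚ.*-identityˡ (seq x n))
                   , (λ x → pointwise λ n → ℚ.*-identityʳ (seq x n))
      ; distrib = (λ x y z → pointwise λ n → ℚ.*-distribˡ-+ (seq x n) (seq y n) (seq z n))
                , (λ x y z → pointwise λ n → ℚ.*-distribʳ-+ (seq x n) (seq y n) (seq z n))
      }
    ; *-comm = λ x y → pointwise λ n → ℚ.*-comm (seq x n) (seq y n)
    }
  }

module ℝ-Ring = CommutativeRing ℝ-commutativeRing

open ℝ-Ring public using ()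
  renaming ( _+_ to infixl 6 _+_; _*_ to infixl 7 _*_; _-_ to infixl 6 _-_
           ; 0# to 0ℝ; 1# to 1ℝ; setoid to ℝ-setoid )

open import Algebra.Properties.CommutativeMonoid.Sum ℝ-Ring.+-commutativeMonoid public
  using (sum; sum-syntax)
open import Algebra.Properties.CommutativeMonoid.Sum ℝ-Ring.+-commutativeMonoid
  using (sum-cong-≋; sum-replicate-zero; ∑-distrib-+)

_when_ : ∀ {p} {P : Set p} → ℝ → Dec P → ℝ
r when P? = if does P? then r else 0ℝ

when-cong : ∀ {p q} {P : Set p} {Q : Set q} {r s}
            (P? : Dec P) (Q? : Dec Q) → (P → Q) → (Q → P) →
            (P → r ≈ᵣ s) → r when P? ≈ᵣ s when Q?
when-cong (yes p) (yes _) _ _ r≈s = r≈s p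
when-cong (no _)  (no _)  _ _ _   = ℝ-Ring.refl
when-cong (yes p) (no ¬q) f _ _   = contradiction (f p) ¬q
when-cong (no ¬p) (yes q) _ g _   = contradiction (g q) ¬p

sum-single : ∀ {n} (i : Fin n) (g : Fin n → ℝ) →
             ∑[ j < n ] (g j when (j Fin.≟ i)) ≈ᵣ g i
sum-single {ℕ.suc n} zero g = ℝ-Ring.trans
  (ℝ-Ring.+-congˡ (sum-replicate-zero n)) (ℝ-Ring.+-identityʳ (g zero))
sum-single {ℕ.suc n} (suc i) g = ℝ-Ring.trans (ℝ-Ring.+-identityˡ _)
  (ℝ-Ring.trans (sum-cong-≋ (λ j → when-cong (suc j Fin.≟ suc i) (j Fin.≟ i)
                    Fin.suc-injective (≡.cong suc) (λ _ → ℝ-Ring.refl)))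
                (sum-single i (λ j → g (suc j))))

-- The enumeration lists every ≈-class exactly once, so sums over the lattice
-- are sums over Fin size.

record FiniteLattice c ℓ₁ ℓ₂ : Set (lsuc (c ⊔ ℓ₁ ⊔ ℓ₂)) where
  field
    boundedLattice : BoundedLattice c ℓ₁ ℓ₂

  open BoundedLattice boundedLattice public

  field
    size        : ℕ
    enumeration : Inverse (≡.setoid (Fin size)) setoid

  open Inverse enumeration public using ()
    renaming ( to to element; from to index; from-cong to index-cong
             ; strictlyInverseˡ to element-index
             ; strictlyInverseʳ to index-element )

  infix 4 _≟_ _≤?_

  _≟_ : Decidable _≈_
  _≟_ = via-injection (Inverse⇒Injection (↔-sym enumeration)) Fin._≟_

  _≤?_ : Decidable _≤_
  _≤?_ = MeetSemilatticeProperties.≈-dec⇒≤-dec meetSemilattice _≟_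

module _ {c ℓ₁ ℓ₂} (L : FiniteLattice c ℓ₁ ℓ₂) where

  open FiniteLattice L

  RealFunction : Set (c ⊔ ℓ₁)
  RealFunction = Func setoid ℝ-setoid

  open Func using () renaming (to to _$ᵣ_; cong to $ᵣ-cong)

  ∑↓ : Carrier → RealFunction → ℝ
  ∑↓ x g = ∑[ i < size ] ((g $ᵣ element i) when (element i ≤? x))

  ∑↑ : Carrier → RealFunction → ℝ
  ∑↑ x g = ∑[ i < size ] ((g $ᵣ element i) when (x ≤? element i))

  IsMöbiusTransform : RealFunction → RealFunction → Set c
  IsMöbiusTransform f m = ∀ x → (f $ᵣ x) ≈ᵣ ∑↓ x m

  private
    _≺_ : Fin size → Fin size → Set (ℓ₁ ⊔ ℓ₂)
    i ≺ j = element i ≤ element j × ¬ (element i ≈ element j)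

    _≺?_ : Decidable _≺_
    i ≺? j = (element i ≤? element j) ×-dec ¬? (element i ≟ element j)

    element-injective : ∀ {i j} → element i ≈ element j → i ≡ j
    element-injective {i} {j} eq =
      ≡.trans (≡.sym (index-element i)) (≡.trans (index-cong eq) (index-element j))

    element-reflexive : ∀ {i j} → i ≡ j → element i ≈ element j
    element-reflexive ≡.refl = Eq.refl

    ≺-wellFounded : WellFounded _≺_
    ≺-wellFounded i = convert (po-wellFounded isPO i)
      where
      _⊑_ : Fin size → Fin size → Set ℓ₂
      j ⊑ k = element j ≤ element k
      isPO : IsPartialOrder _≡_ _⊑_
      isPO = record
        { isPreorder = record
          { isEquivalence = ≡.isEquivalence
          ; reflexive     = λ { ≡.refl → refl }
          ; trans         = trans
          }
        ; antisym = λ p q → element-injective (antisym p q)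
        }
      open import Relation.Binary.Construct.NonStrictToStrict _≡_ _⊑_ using (_<_)
      convert : ∀ {i} → Acc _<_ i → Acc _≺_ i
      convert (acc rs) = acc λ (j≤i , j≉i) →
        convert (rs (j≤i , λ j≡i → j≉i (element-reflexive j≡i)))

    whenAll : ∀ {p} {P : Set p} → Dec P → (P → ℝ) → ℝ
    whenAll (yes p) g = g p
    whenAll (no  _) g = 0ℝ

    -- m(x) = f(x) - ∑_{y < x} m(y)
    recurse : (Fin size → ℝ) → ∀ i → Acc _≺_ i → ℝ
    recurse f i (acc rs) =
      f i - ∑[ j < size ] whenAll (j ≺? i) (λ j≺i → recurse f j (rs j≺i))

    whenAll-cong : ∀ {p} {P : Set p} (P? : Dec P) {g h : P → ℝ} →
                   (∀ p → g p ≈ᵣ h p) → whenAll P? g ≈ᵣ whenAll P? h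
    whenAll-cong (yes p) g≈h = g≈h p
    whenAll-cong (no _)  g≈h = ℝ-Ring.refl

    whenAll-when : ∀ {p} {P : Set p} (P? : Dec P) {g : P → ℝ} {r} →
                   (∀ p → g p ≈ᵣ r) → whenAll P? g ≈ᵣ (r when P?)
    whenAll-when (yes p) g≈r = g≈r p
    whenAll-when (no _)  g≈r = ℝ-Ring.refl

    recurse-irrelevant : ∀ f i (p q : Acc _≺_ i) → recurse f i p ≈ᵣ recurse f i q
    recurse-irrelevant f i (acc rs) (acc rs′) =
      ℝ-Ring.+-congˡ (ℝ-Ring.-‿cong (sum-cong-≋ λ j →
        whenAll-cong (j ≺? i) λ j≺i → recurse-irrelevant f j (rs j≺i) (rs′ j≺i)))

    unfold : ∀ f i (p : Acc _≺_ i) → recurse f i p ≈ᵣ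
             f i - ∑[ j < size ] (recurse f j (≺-wellFounded j) when (j ≺? i))
    unfold f i (acc rs) =
      ℝ-Ring.+-congˡ (ℝ-Ring.-‿cong (sum-cong-≋ λ j →
        whenAll-when (j ≺? i) λ j≺i →
          recurse-irrelevant f j (rs j≺i) (≺-wellFounded j)))

    ∑↓-split : ∀ i (g : Fin size → ℝ) →
      ∑[ j < size ] (g j when (element j ≤? element i)) ≈ᵣ
      g i + ∑[ j < size ] (g j when (j ≺? i))
    ∑↓-split i g = ℝ-Ring.trans (sum-cong-≋ step)
      (ℝ-Ring.trans
        (∑-distrib-+ {size} (λ j → g j when (j Fin.≟ i)) (λ j → g j when (j ≺? i)))
        (ℝ-Ring.+-congʳ (sum-single i g)))
      where
      step : ∀ j → (g j when (element j ≤? element i)) ≈ᵣ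
                   (g j when (j Fin.≟ i)) + (g j when (j ≺? i))
      step j = cases (element j ≤? element i) (j Fin.≟ i) (j ≺? i)
        where
        cases : ∀ (d₁ : Dec (element j ≤ element i)) (d₂ : Dec (j ≡ i)) (d₃ : Dec (j ≺ i)) →
                (g j when d₁) ≈ᵣ (g j when d₂) + (g j when d₃)
        cases _ (yes j≡i) (yes (_ , j≉i)) = contradiction (element-reflexive j≡i) j≉i
        cases (yes _) (yes _) (no _)      = ℝ-Ring.sym (ℝ-Ring.+-identityʳ _)
        cases (yes _) (no _) (yes _)      = ℝ-Ring.sym (ℝ-Ring.+-identityˡ _)
        cases (yes j≤i) (no j≢i) (no j⊀i) =
          contradiction (j≤i , λ eq → j≢i (element-injective eq)) j⊀i
        cases (no j≰i) (yes j≡i) _        =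
          contradiction (reflexive (element-reflexive j≡i)) j≰i
        cases (no j≰i) (no _) (yes j≺i)   = contradiction (proj₁ j≺i) j≰i
        cases (no _) (no _) (no _)        = ℝ-Ring.sym (ℝ-Ring.+-identityˡ _)

    cancel : ∀ x y → (x - y) + y ≈ᵣ x
    cancel x y = ℝ-Ring.trans (ℝ-Ring.+-assoc x _ y)
      (ℝ-Ring.trans (ℝ-Ring.+-congˡ (ℝ-Ring.-‿inverseˡ y)) (ℝ-Ring.+-identityʳ x))

    uncancel : ∀ x y → (x + y) - y ≈ᵣ x
    uncancel x y = ℝ-Ring.trans (ℝ-Ring.+-assoc x y _)
      (ℝ-Ring.trans (ℝ-Ring.+-congˡ (ℝ-Ring.-‿inverseʳ y)) (ℝ-Ring.+-identityʳ x))

  ∑↓-cong : ∀ {x y} g → x ≈ y → ∑↓ x g ≈ᵣ ∑↓ y g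
  ∑↓-cong {x} {y} g x≈y = sum-cong-≋ λ i →
    when-cong (element i ≤? x) (element i ≤? y)
      (λ p → trans p (reflexive x≈y)) (λ p → trans p (reflexive (Eq.sym x≈y)))
      (λ _ → ℝ-Ring.refl)

  ∑↑-cong : ∀ {x y} g → x ≈ y → ∑↑ x g ≈ᵣ ∑↑ y g
  ∑↑-cong {x} {y} g x≈y = sum-cong-≋ λ i →
    when-cong (x ≤? element i) (y ≤? element i)
      (λ p → trans (reflexive (Eq.sym x≈y)) p) (λ p → trans (reflexive x≈y) p)
      (λ _ → ℝ-Ring.refl)

  möbius-∃! : ∀ f → ∃! (λ m m′ → ∀ x → (m $ᵣ x) ≈ᵣ (m′ $ᵣ x)) (IsMöbiusTransform f)
  möbius-∃! f = m , isTransform , λ {m′} → unique m′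
    where
    f∘element : Fin size → ℝ
    f∘element i = f $ᵣ element i

    μ : Fin size → ℝ
    μ i = recurse f∘element i (≺-wellFounded i)

    m : RealFunction
    m = record
      { to   = λ x → μ (index x)
      ; cong = λ x≈y → ℝ-Ring.reflexive (≡.cong μ (index-cong x≈y))
      }

    open import Relation.Binary.Reasoning.Setoid ℝ-setoid

    at-element : ∀ i → f∘element i ≈ᵣ ∑↓ (element i) m
    at-element i = begin
      f∘element i
        ≈⟨ cancel (f∘element i) rest ⟨
      (f∘element i - rest) + rest
        ≈⟨ ℝ-Ring.+-congʳ (unfold f∘element i (≺-wellFounded i)) ⟨
      μ i + rest
        ≈⟨ ∑↓-split i μ ⟨
      ∑[ j < size ] (μ j when (element j ≤? element i))
        ≈⟨ sum-cong-≋ (λ j → when-cong (element j ≤? element i) (element j ≤? element i)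
             (λ p → p) (λ p → p)
             (λ _ → ℝ-Ring.reflexive (≡.cong μ (≡.sym (index-element j))))) ⟩
      ∑↓ (element i) m
        ∎
      where rest = ∑[ j < size ] (μ j when (j ≺? i))

    isTransform : IsMöbiusTransform f m
    isTransform x = begin
      f $ᵣ x                    ≈⟨ $ᵣ-cong f (element-index x) ⟨
      f $ᵣ element (index x)    ≈⟨ at-element (index x) ⟩
      ∑↓ (element (index x)) m  ≈⟨ ∑↓-cong m (element-index x) ⟩
      ∑↓ x m                    ∎

    unique-at : ∀ m′ → IsMöbiusTransform f m′ →
                ∀ i → Acc _≺_ i → μ i ≈ᵣ (m′ $ᵣ element i)
    unique-at m′ h i (acc rs) = begin
      μ i
        ≈⟨ unfold f∘element i (≺-wellFounded i) ⟩
      f∘element i - ∑[ j < size ] (μ j when (j ≺? i))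
        ≈⟨ ℝ-Ring.+-cong (h (element i)) (ℝ-Ring.-‿cong (sum-cong-≋ λ j →
             when-cong (j ≺? i) (j ≺? i) (λ p → p) (λ p → p)
               (λ j≺i → unique-at m′ h j (rs j≺i)))) ⟩
      ∑↓ (element i) m′ - rest
        ≈⟨ ℝ-Ring.+-congʳ (∑↓-split i (λ j → m′ $ᵣ element j)) ⟩
      ((m′ $ᵣ element i) + rest) - rest
        ≈⟨ uncancel _ rest ⟩
      m′ $ᵣ element i
        ∎
      where rest = ∑[ j < size ] ((m′ $ᵣ element j) when (j ≺? i))

    unique : ∀ m′ → IsMöbiusTransform f m′ → ∀ x → (m $ᵣ x) ≈ᵣ (m′ $ᵣ x)
    unique m′ h x = ℝ-Ring.trans
      (unique-at m′ h (index x) (≺-wellFounded (index x)))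
      ($ᵣ-cong m′ (element-index x))

  möbius : RealFunction → RealFunction
  möbius f = proj₁ (möbius-∃! f)

  coMöbius : RealFunction → RealFunction
  coMöbius f = record
    { to   = λ x → ∑↑ x (möbius f)
    ; cong = ∑↑-cong (möbius f)
    }

  record IsBelief (bel : RealFunction) : Set (c ⊔ ℓ₁) where
    field
      nonNegative        : ∀ x → 0ℝ ≤ᵣ (bel $ᵣ x)
      atMostOne          : ∀ x → (bel $ᵣ x) ≤ᵣ 1ℝ
      at-⊤               : (bel $ᵣ ⊤) ≈ᵣ 1ℝ
      at-⊥               : (bel $ᵣ ⊥) ≈ᵣ 0ℝ
      möbius-nonNegative : ∀ x → 0ℝ ≤ᵣ (möbius bel $ᵣ x)

  record BeliefFunction : Set (c ⊔ ℓ₁) where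
    field
      bel      : RealFunction
      isBelief : IsBelief bel

  dempsterMass : (m₁ m₂ : RealFunction) → RealFunction
  dempsterMass m₁ m₂ = record
    { to   = λ x → ∑[ i < size ] ∑[ j < size ]
               (((m₁ $ᵣ element i) * (m₂ $ᵣ element j))
                 when ((element i ∧ element j) ≟ x))
    ; cong = λ {x} {y} x≈y → sum-cong-≋ λ i → sum-cong-≋ λ j →
               when-cong ((element i ∧ element j) ≟ x) ((element i ∧ element j) ≟ y)
                 (λ p → Eq.trans p x≈y) (λ p → Eq.trans p (Eq.sym x≈y))
                 (λ _ → ℝ-Ring.refl)
    }

  -- A function is determined by its Möbius transform m as x ↦ ∑_{y ≤ x} m(y).
  -- There is no normalization: the value at ⊥ need not be 0.

  dempster : BeliefFunction → BeliefFunction → RealFunction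
  dempster b₁ b₂ = record
    { to   = λ x → ∑↓ x mass
    ; cong = ∑↓-cong mass
    }
    where
    mass : RealFunction
    mass = dempsterMass (möbius (BeliefFunction.bel b₁)) (möbius (BeliefFunction.bel b₂))

{-# OPTIONS --safe #-}
-- Summing the Dempster mass over the up-set of x collapses the sum over the
-- fibres of ∧, leaving the pairs (y₁ , y₂) with x ≤ y₁ ∧ y₂.  This condition
-- means x ≤ y₁ and x ≤ y₂, so the double sum factors.
module Submission where

open import Defs
open import Data.Fin.Base using (Fin)
import Data.Fin.Properties as Fin
open import Data.Product.Base using (_,_; proj₂)
open import Function.Bundles using (Func)
open import Relation.Binary.PropositionalEquality as ≡ using ()
open import Relation.Nullary using (Dec; yes; no)
open import Relation.Nullary.Decidable using (_×-dec_)

open import Algebra.Properties.Semiring.Sum ℝ-Ring.semiring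
  using (sum-cong-≋; sum-replicate-zero; ∑-comm; *-distribˡ-sum; *-distribʳ-sum)
open import Relation.Binary.Reasoning.Setoid ℝ-setoid

when-congˡ : ∀ {p} {P : Set p} {r s} (P? : Dec P) →
             r ≈ᵣ s → r when P? ≈ᵣ s when P?
when-congˡ P? r≈s = when-cong P? P? (λ p → p) (λ p → p) (λ _ → r≈s)

-- Merging nested guards into one lets `∑↑-fibre` trade a pair of conditions for an equivalent pair.
when-× : ∀ {p q} {P : Set p} {Q : Set q} {r}
         (P? : Dec P) (Q? : Dec Q) →
         (r when P?) when Q? ≈ᵣ r when (P? ×-dec Q?)
when-× (yes _) (yes _) = ℝ-Ring.refl
when-× (yes _) (no _)  = ℝ-Ring.refl
when-× (no _)  (yes _) = ℝ-Ring.refl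
when-× (no _)  (no _)  = ℝ-Ring.refl

*-when : ∀ {p q} {P : Set p} {Q : Set q} {r s}
         (P? : Dec P) (Q? : Dec Q) →
         (r when P?) * (s when Q?) ≈ᵣ (r * s) when (P? ×-dec Q?)
*-when (yes _) (yes _) = ℝ-Ring.refl
*-when (yes _) (no _)  = ℝ-Ring.zeroʳ _
*-when (no _)  (yes _) = ℝ-Ring.zeroˡ _
*-when (no _)  (no _)  = ℝ-Ring.zeroˡ _

sum-when : ∀ {p} {P : Set p} (P? : Dec P) {n} (g : Fin n → ℝ) →
           (∑[ i < n ] g i) when P? ≈ᵣ ∑[ i < n ] (g i when P?)
sum-when (yes _)     g = ℝ-Ring.refl
sum-when (no _)  {n} g = ℝ-Ring.sym (sum-replicate-zero n)

sum-*-sum : ∀ {m n} (f : Fin m → ℝ) (g : Fin n → ℝ) →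
            sum f * sum g ≈ᵣ ∑[ i < m ] ∑[ j < n ] (f i * g j)
sum-*-sum f g = ℝ-Ring.trans (*-distribʳ-sum (sum g) f)
  (sum-cong-≋ λ i → *-distribˡ-sum (f i) g)

module _ {c ℓ₁ ℓ₂} (L : FiniteLattice c ℓ₁ ℓ₂) where

  open FiniteLattice L
  open Func using () renaming (to to _$ᵣ_)

  -- The enumeration meets the class of `y` exactly once, at `index y`, so a single `k` survives; at
  -- that `k` the guard `x ≤ element k` amounts to `x ≤ y`.
  ∑↑-fibre : ∀ x y r →
    ∑[ k < size ] ((r when (y ≟ element k)) when (x ≤? element k)) ≈ᵣ
    r when (x ≤? y)
  ∑↑-fibre x y r = ℝ-Ring.trans (sum-cong-≋ step)
    (sum-single (index y) (λ _ → r when (x ≤? y)))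
    where
    step : ∀ k → (r when (y ≟ element k)) when (x ≤? element k) ≈ᵣ
                 (r when (x ≤? y)) when (k Fin.≟ index y)
    step k = begin
      (r when (y ≟ element k)) when (x ≤? element k)
        ≈⟨ when-× (y ≟ element k) (x ≤? element k) ⟩
      r when ((y ≟ element k) ×-dec (x ≤? element k))
        ≈⟨ when-cong ((y ≟ element k) ×-dec (x ≤? element k))
             ((x ≤? y) ×-dec (k Fin.≟ index y))
             (λ (y≈k , x≤k) → trans x≤k (reflexive (Eq.sym y≈k))
                            , ≡.trans (≡.sym (index-element k)) (index-cong (Eq.sym y≈k)))
             -- Matching on `≡.refl` puts `index y` for `k`, and `element (index y)` equals `y` only
             -- up to `≈`.
             (λ { (x≤y , ≡.refl) → Eq.sym (element-index y)
                                 , trans x≤y (reflexive (Eq.sym (element-index y))) })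
             (λ _ → ℝ-Ring.refl) ⟩
      r when ((x ≤? y) ×-dec (k Fin.≟ index y))
        ≈⟨ when-× (x ≤? y) (k Fin.≟ index y) ⟨
      (r when (x ≤? y)) when (k Fin.≟ index y)
        ∎

  -- The universal property of the meet: an element lies below `y ∧ z` exactly when it lies below
  -- both, so the indicator of an up-set is multiplicative on meets.
  when-∧ : ∀ x y z r s →
    (r * s) when (x ≤? (y ∧ z)) ≈ᵣ (r when (x ≤? y)) * (s when (x ≤? z))
  when-∧ x y z r s = ℝ-Ring.trans
    (when-cong (x ≤? (y ∧ z)) ((x ≤? y) ×-dec (x ≤? z))
      (λ x≤y∧z → trans x≤y∧z (x∧y≤x y z) , trans x≤y∧z (x∧y≤y y z))
      (λ (x≤y , x≤z) → ∧-greatest x≤y x≤z)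
      (λ _ → ℝ-Ring.refl))
    (ℝ-Ring.sym (*-when (x ≤? y) (x ≤? z)))

  ∑↑-dempsterMass : ∀ m₁ m₂ x →
    ∑↑ L x (dempsterMass L m₁ m₂) ≈ᵣ ∑↑ L x m₁ * ∑↑ L x m₂
  ∑↑-dempsterMass m₁ m₂ x = begin
    ∑[ k < size ] ((∑[ i < size ] ∑[ j < size ] (m i j when (meet i j ≟ element k)))
                     when (x ≤? element k))
      -- The outer guard depends on `k` alone, so it passes through the sums over `i` and `j`.
      ≈⟨ sum-cong-≋ (λ k → ℝ-Ring.trans (sum-when (x ≤? element k) {size} _)
           (sum-cong-≋ {size} λ i → sum-when (x ≤? element k) {size} _)) ⟩
    ∑[ k < size ] ∑[ i < size ] ∑[ j < size ] term i j k
      -- Two exchanges bring the sum over `k` innermost, where `i` and `j` are fixed and `∑↑-fibre`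
      -- applies.
      ≈⟨ ∑-comm (λ k i → ∑[ j < size ] term i j k) ⟩
    ∑[ i < size ] ∑[ k < size ] ∑[ j < size ] term i j k
      ≈⟨ sum-cong-≋ (λ i → ∑-comm (λ k j → term i j k)) ⟩
    ∑[ i < size ] ∑[ j < size ] ∑[ k < size ] term i j k
      ≈⟨ sum-cong-≋ (λ i → sum-cong-≋ λ j → ℝ-Ring.trans
           (∑↑-fibre x (meet i j) (m i j))
           (when-∧ x (element i) (element j) (m₁ $ᵣ element i) (m₂ $ᵣ element j))) ⟩
    ∑[ i < size ] ∑[ j < size ]
      (((m₁ $ᵣ element i) when (x ≤? element i)) * ((m₂ $ᵣ element j) when (x ≤? element j)))
      ≈⟨ sum-*-sum {size} {size} _ _ ⟨
    ∑↑ L x m₁ * ∑↑ L x m₂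
      ∎
    where
    m : Fin size → Fin size → ℝ
    m i j = (m₁ $ᵣ element i) * (m₂ $ᵣ element j)

    meet : Fin size → Fin size → Carrier
    meet i j = element i ∧ element j

    term : Fin size → Fin size → Fin size → ℝ
    term i j k = (m i j when (meet i j ≟ element k)) when (x ≤? element k)

  -- `coMöbius` is built on the recursively constructed transform; uniqueness of Möbius transforms
  -- lets any other one take its place.
  coMöbius-unique : ∀ f m → IsMöbiusTransform L f m →
                    ∀ x → (coMöbius L f $ᵣ x) ≈ᵣ ∑↑ L x m
  coMöbius-unique f m f≈∑↓m x = sum-cong-≋ λ i →
    when-congˡ (x ≤? element i) (proj₂ (proj₂ (möbius-∃! L f)) {m} f≈∑↓m (element i))

proposition4 :
    ∀ {c ℓ₁ ℓ₂} (L : FiniteLattice c ℓ₁ ℓ₂) →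
    let open FiniteLattice L using (Carrier)
        open BeliefFunction using (bel)
        open Func using () renaming (to to _$ᵣ_)
    in
    (bel₁ bel₂ : BeliefFunction L) (x : Carrier) →
    (coMöbius L (dempster L bel₁ bel₂) $ᵣ x) ≈ᵣ
    ((coMöbius L (bel bel₁) $ᵣ x) * (coMöbius L (bel bel₂) $ᵣ x))
proposition4 L bel₁ bel₂ x = ℝ-Ring.trans
  -- `dempster` is by definition the down-set sum of its mass, so reflexivity shows that this mass
  -- is its Möbius transform.
  (coMöbius-unique L (dempster L bel₁ bel₂) (dempsterMass L m₁ m₂) (λ _ → ℝ-Ring.refl) x)
  (∑↑-dempsterMass L m₁ m₂ x)
  where
  open BeliefFunction using (bel)
  m₁ = möbius L (bel bel₁)
  m₂ = möbius L (bel bel₂)
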